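{- Consider finite structures of a fixed finite signature (possibly with operations of positive arity). (i) A property $\mathcal{P}$ of finite structures is not expressible in first order logic if for every $n\in\mathbb{N}$ there exist two finite structures $\mathbf{A}_n$ and $\mathbf{B}_n$ such that $\mathbf{A}_n\equiv_n\mathbf{B}_n$, and $\mathbf{A}_n$ has property $\mathcal{P}$ while $\mathbf{B}_n$ does not. (ii) When relativised to any uniformly locally finite class of finite structures, the converse also holds: if $\mathscr{U}$ is a uniformly locally finite class of finite structures and the property $\mathcal{P}$ is not expressible in first order logic within $\mathscr{U}$ (there is no first order sentence $\Phi$ such that for all $\mathbf{A}\in\mathscr{U}$, $\mathbf{A}\models\Phi$ if and only if $\mathbf{A}$ has property $\mathcal{P}$), then for every $n\in\mathbb{N}$ there exist $\mathbf{A}_n,\mathbf{B}_n\in\mathscr{U}$ such that $\mathbf{A}_n\equiv_n\mathbf{B}_n$, and $\mathbf{A}_n$ has property $\mathcal{P}$ while $\mathbf{B}_n$ does not.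
   Context: The relation $\equiv_n$ is defined by the following $n$-round Ehrenfeucht-Fraïssé game between Spoiler and Duplicator on two finite structures $\mathbf{A},\mathbf{B}$ of the same finite signature. In each round Spoiler picks one of the two structures and selects an element of it, and Duplicator responds by selecting an element of the other structure. After $n$ rounds, elements $a_1,\dots,a_n$ of $A$ and $b_1,\dots,b_n$ of $B$ have been selected ($a_i,b_i$ in round $i$). Duplicator wins if the map $a_i\mapsto b_i$ extends to an isomorphism between the substructure of $\mathbf{A}$ generated by $\{a_1,\dots,a_n\}$ and the substructure of $\mathbf{B}$ generated by $\{b_1,\dots,b_n\}$. Write $\mathbf{A}\equiv_n\mathbf{B}$ if Duplicator has a winning strategy for the $n$-round game. A class of structures is uniformly locally finite if for every $n$ there exists $m$ such that every $n$-generated substructure of a member of the class has at most $m$ elements. A property of structures is understood to be isomorphism invariant. A property $\mathcal P$ is expressible in first order logic if there is a first order sentence whose finite models are exactly the finite structures with property $\mathcal P$. -}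

module Defs where

open import Data.Empty using (⊥)
open import Data.Fin.Base using (Fin)
open import Data.Irrelevant as Irrelevant using (Irrelevant; [_])
open import Data.Nat.Base using (ℕ; zero; suc)
open import Data.Product.Base using (Σ-syntax; ∃-syntax; _×_)
open import Data.Refinement using (Refinement; value; proof; _,_)
open import Data.Sum.Base using (_⊎_)
open import Data.Vec.Base using (Vec; []; _∷_; lookup; map)
open import Data.Vec.Relation.Unary.All using (All; []; _∷_)
open import Function.Bundles using (_↔_; _⇔_; _↣_; Inverse)
open import Level using (Level; 0ℓ; _⊔_) renaming (suc to lsuc)
open import Relation.Binary.PropositionalEquality.Core using (_≡_)

-- Operations of arity 0 are the constants.
record Signature : Set where
  field
    #ops     : ℕ
    opArity  : Fin #ops → ℕ
    #rels    : ℕ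
    relArity : Fin #rels → ℕ

open Signature public

record Structure (σ : Signature) : Set₁ where
  field
    Carrier : Set
    op      : (f : Fin (#ops σ)) → Vec Carrier (opArity σ f) → Carrier
    rel     : (r : Fin (#rels σ)) → Vec Carrier (relArity σ r) → Set

open Structure public

-- Nonemptiness is required here and not in Structure, because a substructure
-- generated by no elements may be empty.
record FiniteStructure (σ : Signature) : Set₁ where
  field
    structure : Structure σ
    nonempty  : Carrier structure
    finite    : ∃[ k ] (Carrier structure ↔ Fin k)

open FiniteStructure public

record _≅_ {σ : Signature} (A B : Structure σ) : Set where
  field
    bijection : Carrier A ↔ Carrier B

  to : Carrier A → Carrier B
  to = Inverse.to bijection

  field
    op-homo : ∀ f xs → to (op A f xs) ≡ op B f (map to xs)
    rel-iff : ∀ r xs → rel A r xs ⇔ rel B r (map to xs)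

infix 4 _≅_

data Generated {σ : Signature} (A : Structure σ) {n : ℕ}
               (as : Vec (Carrier A) n) : Carrier A → Set where
  generator : ∀ i → Generated A as (lookup as i)
  apply     : ∀ f {xs} → All (Generated A as) xs → Generated A as (op A f xs)

allGenerated : ∀ {σ : Signature} (A : Structure σ) {n : ℕ} (as : Vec (Carrier A) n)
               {k : ℕ} (xs : Vec (Refinement (Carrier A) (Generated A as)) k) →
               Irrelevant (All (Generated A as) (map value xs))
allGenerated A as []       = [ [] ]
allGenerated A as (x ∷ xs) = Irrelevant.zipWith _∷_ (proof x) (allGenerated A as xs)

-- The membership proof in a Refinement is irrelevant, so the elements of the
-- substructure are elements of A, not ways of generating them.
⟨_∣_⟩ : ∀ {σ : Signature} (A : Structure σ) {n : ℕ} → Vec (Carrier A) n → Structure σ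
⟨ A ∣ as ⟩ = record
  { Carrier = Refinement (Carrier A) (Generated A as)
  ; op      = λ f xs → op A f (map value xs) , Irrelevant.map (apply f) (allGenerated A as xs)
  ; rel     = λ r xs → rel A r (map value xs)
  }

gen : ∀ {σ : Signature} (A : Structure σ) {n : ℕ} (as : Vec (Carrier A) n) →
      Fin n → Carrier ⟨ A ∣ as ⟩
gen A as i = lookup as i , [ generator i ]

FinalWin : ∀ {σ : Signature} (A B : Structure σ) {n : ℕ} →
           Vec (Carrier A) n → Vec (Carrier B) n → Set
FinalWin A B as bs =
  Σ[ h ∈ ⟨ A ∣ as ⟩ ≅ ⟨ B ∣ bs ⟩ ] (∀ i → _≅_.to h (gen A as i) ≡ gen B bs i)

-- A winning strategy for Duplicator with r rounds left, from the elements chosen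
-- so far (latest first). The two components answer Spoiler's moves in A and in B.
-- The winning condition is only tested when no round is left.
WinningStrategy : ∀ {σ : Signature} (A B : Structure σ) (r : ℕ) {n : ℕ} →
                  Vec (Carrier A) n → Vec (Carrier B) n → Set
WinningStrategy A B zero    as bs = FinalWin A B as bs
WinningStrategy A B (suc r) as bs =
  (∀ a → ∃[ b ] WinningStrategy A B r (a ∷ as) (b ∷ bs)) ×
  (∀ b → ∃[ a ] WinningStrategy A B r (a ∷ as) (b ∷ bs))

infix 4 _≡[_]_

_≡[_]_ : ∀ {σ : Signature} → FiniteStructure σ → ℕ → FiniteStructure σ → Set
A ≡[ n ] B = WinningStrategy (structure A) (structure B) n [] []

data Term (σ : Signature) (k : ℕ) : Set where
  var : Fin k → Term σ k
  app : (f : Fin (#ops σ)) → Vec (Term σ k) (opArity σ f) → Term σ k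

infix  7 _≐_
infixr 6 _∧̇_
infixr 5 _∨̇_
infixr 4 _⇒̇_

-- Formulas with free variables in Fin k (de Bruijn indices: a quantifier binds
-- index zero). Negation of φ is φ ⇒̇ ⊥̇.
data Formula (σ : Signature) (k : ℕ) : Set where
  _≐_         : Term σ k → Term σ k → Formula σ k
  atom        : (r : Fin (#rels σ)) → Vec (Term σ k) (relArity σ r) → Formula σ k
  ⊥̇           : Formula σ k
  _∧̇_ _∨̇_ _⇒̇_ : Formula σ k → Formula σ k → Formula σ k
  ∀̇_ ∃̇_       : Formula σ (suc k) → Formula σ k

Sentence : Signature → Set
Sentence σ = Formula σ 0

module _ {σ : Signature} (A : Structure σ) where

  mutual
    eval : ∀ {k} → Vec (Carrier A) k → Term σ k → Carrier A
    eval ρ (var i)    = lookup ρ i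
    eval ρ (app f ts) = op A f (evals ρ ts)

    evals : ∀ {k n} → Vec (Carrier A) k → Vec (Term σ k) n → Vec (Carrier A) n
    evals ρ []       = []
    evals ρ (t ∷ ts) = eval ρ t ∷ evals ρ ts

  Sat : ∀ {k} → Vec (Carrier A) k → Formula σ k → Set
  Sat ρ (s ≐ t)     = eval ρ s ≡ eval ρ t
  Sat ρ (atom r ts) = rel A r (evals ρ ts)
  Sat ρ ⊥̇           = ⊥
  Sat ρ (φ ∧̇ ψ)     = Sat ρ φ × Sat ρ ψ
  Sat ρ (φ ∨̇ ψ)     = Sat ρ φ ⊎ Sat ρ ψ
  Sat ρ (φ ⇒̇ ψ)     = Sat ρ φ → Sat ρ ψ
  Sat ρ (∀̇ φ)       = ∀ a → Sat (a ∷ ρ) φ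
  Sat ρ (∃̇ φ)       = ∃[ a ] Sat (a ∷ ρ) φ

infix 4 _⊨_

_⊨_ : ∀ {σ : Signature} → FiniteStructure σ → Sentence σ → Set
A ⊨ Φ = Sat (structure A) [] Φ

record Property (σ : Signature) (p : Level) : Set (lsuc p ⊔ lsuc 0ℓ) where
  field
    Has       : FiniteStructure σ → Set p
    invariant : ∀ {A B} → structure A ≅ structure B → Has A → Has B

open Property public

Class : Signature → (u : Level) → Set (lsuc u ⊔ lsuc 0ℓ)
Class σ u = FiniteStructure σ → Set u

Expressible : ∀ {σ : Signature} {p : Level} → Property σ p → Set (p ⊔ lsuc 0ℓ)
Expressible {σ} P = ∃[ Φ ] (∀ (A : FiniteStructure σ) → A ⊨ Φ ⇔ Has P A)

ExpressibleWithin : ∀ {σ : Signature} {p u : Level} → Class σ u → Property σ p →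
                    Set (p ⊔ u ⊔ lsuc 0ℓ)
ExpressibleWithin {σ} 𝒰 P =
  ∃[ Φ ] (∀ (A : FiniteStructure σ) → 𝒰 A → A ⊨ Φ ⇔ Has P A)

UniformlyLocallyFinite : ∀ {σ : Signature} {u : Level} → Class σ u →
                         Set (u ⊔ lsuc 0ℓ)
UniformlyLocallyFinite {σ} 𝒰 =
  ∀ (n : ℕ) → ∃[ m ] (∀ (A : FiniteStructure σ) → 𝒰 A →
    (as : Vec (Carrier (structure A)) n) → Carrier ⟨ structure A ∣ as ⟩ ↣ Fin m)

{-# OPTIONS --safe #-}

-- (i) A winning strategy with r rounds left makes the tuples chosen so far agree
-- on all formulas of quantifier depth at most r; terms need no bound, since the
-- final isomorphism is one of generated substructures.
--
-- (ii) If n-generated substructures have at most m elements, then their elements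
-- are the values of the finitely many terms of depth at most m.  So the isomorphism
-- type of the substructure generated by an n-tuple is described by finitely many
-- atomic formulas, and inductively there is a finite list of sentences on which
-- agreement implies ≡ₙ.  If no A ≡ₙ B in 𝒰 were separated by P, then P would be
-- expressed by the disjunction of the complete types over this list that are
-- realised by the structures in 𝒰 with P.
module Submission where

open import Defs
open import Axiom.DoubleNegationElimination using (em⇒dne)
open import Axiom.ExcludedMiddle using (ExcludedMiddle)
open import Data.Fin.Base using (Fin; zero; suc; toℕ) renaming (_<_ to _<ᶠ_)
open import Data.Fin.Properties using (pigeonhole; toℕ<n)
open import Data.Irrelevant using ([_])
open import Data.List.Base
  using (List; []; _∷_; _++_; allFin; cartesianProductWith; concatMap; filter; foldr)
  renaming (map to mapᴸ)
open import Data.List.Membership.Propositional using (_∈_; lose)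
open import Data.List.Membership.Propositional.Properties
  using (∈-++⁺ˡ; ∈-++⁺ʳ; ∈-++⁻; ∈-map⁺; ∈-map⁻; ∈-concatMap⁺; ∈-allFin;
         ∈-cartesianProductWith⁺; ∈-filter⁺; ∈-filter⁻)
open import Data.List.Relation.Unary.Any using (here; there)
open import Data.Nat.Base using (ℕ; zero; suc; _≤_; s≤s; s≤s⁻¹; _≤′_; ≤′-refl; ≤′-step)
  renaming (_⊔_ to _⊔ⁿ_)
open import Data.Nat.Properties using (≤-refl; n<1+n; m⊔n≤o⇒m≤o; m⊔n≤o⇒n≤o; ≤⇒≤′)
open import Data.Product.Base using (∃₂; ∃-syntax; _×_; _,_; proj₁; proj₂)
open import Data.Product.Function.NonDependent.Propositional using (_×-⇔_)
open import Data.Refinement using (value; _,_)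
open import Data.Sum.Base using (inj₁; inj₂)
open import Data.Sum.Function.Propositional using (_⊎-⇔_)
open import Data.Vec.Base using (Vec; []; _∷_; map)
open import Data.Vec.Relation.Unary.All using (All; []; _∷_)
open import Function.Base using (id; _∘_)
open import Function.Bundles using (_⇔_; _↣_; mk⇔; mk↔ₛ′; Inverse; Equivalence; Injection)
open import Function.Properties.Equivalence using (⇔-isEquivalence)
open import Function.Related.TypeIsomorphisms using (→-cong-⇔)
open import Level using (Level; 0ℓ; Lift; lift; lower; _⊔_) renaming (suc to lsuc)
open import Relation.Binary.PropositionalEquality.Core
  using (_≡_; refl; sym; trans; cong; cong₂; subst)
open import Relation.Binary.Structures using (module IsEquivalence)
open import Relation.Nullary.Decidable using (Dec; yes; no; map′; recompute)
open import Relation.Nullary.Negation using (¬_; contradiction)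

open Equivalence using (to; from)
module ⇔ {ℓ : Level} = IsEquivalence (⇔-isEquivalence {ℓ})

private variable
  a   : Level
  σ   : Signature
  k n : ℕ

-- Excluded middle is assumed once, at the join of all levels involved; satisfaction of formulas and
-- the property itself live at smaller levels.
lower-em : ∀ b → ExcludedMiddle (a ⊔ b) → ExcludedMiddle a
lower-em b em {P} = map′ lower lift (em {Lift b P})

-- Agreement of tuples on formulas

Agree : (A B : Structure σ) → Vec (Carrier A) k → Vec (Carrier B) k → Formula σ k → Set
Agree A B as bs φ = Sat A as φ ⇔ Sat B bs φ

mutual
  -- The index shift compensates for the element that a dummy move puts at the head of the tuple.
  weaken : Term σ k → Term σ (suc k)
  weaken (var i)    = var (suc i)
  weaken (app f ts) = app f (weakens ts)

  weakens : Vec (Term σ k) n → Vec (Term σ (suc k)) n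
  weakens []       = []
  weakens (t ∷ ts) = weaken t ∷ weakens ts

module _ (A : Structure σ) {k : ℕ} (a : Carrier A) (as : Vec (Carrier A) k) where

  mutual
    eval-weaken : ∀ t → eval A (a ∷ as) (weaken t) ≡ eval A as t
    eval-weaken (var i)    = refl
    eval-weaken (app f ts) = cong (op A f) (evals-weakens ts)

    evals-weakens : ∀ {n} (ts : Vec (Term σ k) n) →
                    evals A (a ∷ as) (weakens ts) ≡ evals A as ts
    evals-weakens []       = refl
    evals-weakens (t ∷ ts) = cong₂ _∷_ (eval-weaken t) (evals-weakens ts)

  sat-weaken-≐ : ∀ s t → Sat A (a ∷ as) (weaken s ≐ weaken t) ⇔ Sat A as (s ≐ t)
  sat-weaken-≐ s t rewrite eval-weaken s | eval-weaken t = ⇔.refl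

  sat-weaken-atom : ∀ r ts → Sat A (a ∷ as) (atom r (weakens ts)) ⇔ Sat A as (atom r ts)
  sat-weaken-atom r ts rewrite evals-weakens ts = ⇔.refl

module _ (A : Structure σ) {k : ℕ} (as : Vec (Carrier A) k) where

  mutual
    eval-generated : ∀ t → Generated A as (eval A as t)
    eval-generated (var i)    = generator i
    eval-generated (app f ts) = apply f (evals-generated ts)

    evals-generated : ∀ {n} (ts : Vec (Term σ k) n) → All (Generated A as) (evals A as ts)
    evals-generated []       = []
    evals-generated (t ∷ ts) = eval-generated t ∷ evals-generated ts

  ⟦_⟧ : Term σ k → Carrier ⟨ A ∣ as ⟩
  ⟦ t ⟧ = eval A as t , [ eval-generated t ]

  map-value-⟦⟧ : ∀ {n} (ts : Vec (Term σ k) n) → map value (map ⟦_⟧ ts) ≡ evals A as ts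
  map-value-⟦⟧ []       = refl
  map-value-⟦⟧ (t ∷ ts) = cong (eval A as t ∷_) (map-value-⟦⟧ ts)

  value-injective : {x y : Carrier ⟨ A ∣ as ⟩} → value x ≡ value y → x ≡ y
  value-injective refl = refl

module _ (A B : Structure σ) {k : ℕ} {as : Vec (Carrier A) k} {bs : Vec (Carrier B) k}
         (win : FinalWin A B as bs) where

  private
    h = _≅_.to (proj₁ win)

  mutual
    -- A homomorphism is determined by its values on the generators, by induction on terms.
    iso-⟦⟧ : ∀ t → h (⟦_⟧ A as t) ≡ ⟦_⟧ B bs t
    iso-⟦⟧ (var i)    = proj₂ win i
    -- Operations of the substructure act on underlying elements, so the arguments are first
    -- rewritten as the values of `map ⟦_⟧ ts`, where `op-homo` applies.
    iso-⟦⟧ (app f ts) = trans (cong h (value-injective A as (cong (op A f) (sym (map-value-⟦⟧ A as ts)))))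
                       (trans (_≅_.op-homo (proj₁ win) f (map (⟦_⟧ A as) ts))
                              (value-injective B bs (cong (op B f) (map-iso-⟦⟧ ts))))

    map-iso-⟦⟧ : ∀ {n} (ts : Vec (Term σ k) n) →
                 map value (map h (map (⟦_⟧ A as) ts)) ≡ evals B bs ts
    map-iso-⟦⟧ []       = refl
    map-iso-⟦⟧ (t ∷ ts) = cong₂ _∷_ (cong value (iso-⟦⟧ t)) (map-iso-⟦⟧ ts)

  finalWin⇒agree-atom : ∀ r ts → Agree A B as bs (atom r ts)
  finalWin⇒agree-atom r ts
    with iff ← _≅_.rel-iff (proj₁ win) r (map (⟦_⟧ A as) ts)
    rewrite map-value-⟦⟧ A as ts | map-iso-⟦⟧ ts = iff

  finalWin⇒agree-≐ : ∀ s t → Agree A B as bs (s ≐ t)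
  finalWin⇒agree-≐ s t = mk⇔
    (λ eq → trans (sym (cong value (iso-⟦⟧ s)))
           (trans (cong (value ∘ h) (value-injective A as eq)) (cong value (iso-⟦⟧ t))))
    (λ eq → cong value (h-injective (trans (iso-⟦⟧ s)
                                    (trans (value-injective B bs eq) (sym (iso-⟦⟧ t))))))
    where
    open Inverse (_≅_.bijection (proj₁ win)) using (strictlyInverseʳ) renaming (from to h⁻¹)

    h-injective : ∀ {x y} → h x ≡ h y → x ≡ y
    h-injective {x} {y} eq =
      trans (sym (strictlyInverseʳ x)) (trans (cong h⁻¹ eq) (strictlyInverseʳ y))

-- Formulas preserved by a winning strategy

quantifierDepth : Formula σ k → ℕ
quantifierDepth (s ≐ t)     = 0
quantifierDepth (atom r ts) = 0
quantifierDepth ⊥̇           = 0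
quantifierDepth (φ ∧̇ ψ)     = quantifierDepth φ ⊔ⁿ quantifierDepth ψ
quantifierDepth (φ ∨̇ ψ)     = quantifierDepth φ ⊔ⁿ quantifierDepth ψ
quantifierDepth (φ ⇒̇ ψ)     = quantifierDepth φ ⊔ⁿ quantifierDepth ψ
quantifierDepth (∀̇ φ)       = suc (quantifierDepth φ)
quantifierDepth (∃̇ φ)       = suc (quantifierDepth φ)

module _ (A B : Structure σ) (a₀ : Carrier A) where

  -- For atomic formulas the remaining rounds are played with a dummy move a₀.
  win⇒agree-≐ : ∀ r {k} {as : Vec (Carrier A) k} {bs : Vec (Carrier B) k} →
                WinningStrategy A B r as bs → ∀ s t → Agree A B as bs (s ≐ t)
  win⇒agree-≐ zero    win s t = finalWin⇒agree-≐ A B win s t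
  win⇒agree-≐ (suc r) {as = as} {bs} (forth , _) s t with b , win ← forth a₀ =
    ⇔.trans (⇔.sym (sat-weaken-≐ A a₀ as s t))
   (⇔.trans (win⇒agree-≐ r win (weaken s) (weaken t)) (sat-weaken-≐ B b bs s t))

  win⇒agree-atom : ∀ r {k} {as : Vec (Carrier A) k} {bs : Vec (Carrier B) k} →
                   WinningStrategy A B r as bs → ∀ R ts → Agree A B as bs (atom R ts)
  win⇒agree-atom zero    win R ts = finalWin⇒agree-atom A B win R ts
  win⇒agree-atom (suc r) {as = as} {bs} (forth , _) R ts with b , win ← forth a₀ =
    ⇔.trans (⇔.sym (sat-weaken-atom A a₀ as R ts))
   (⇔.trans (win⇒agree-atom r win R (weakens ts)) (sat-weaken-atom B b bs R ts))

  -- Each quantifier consumes one round. The depth is only bounded by `r`, since the two parts of a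
  -- connective may differ in depth.
  win⇒agree : ∀ r {k} {as : Vec (Carrier A) k} {bs : Vec (Carrier B) k} →
              WinningStrategy A B r as bs → ∀ φ → quantifierDepth φ ≤ r → Agree A B as bs φ
  win⇒agree r win (s ≐ t)     q = win⇒agree-≐ r win s t
  win⇒agree r win (atom R ts) q = win⇒agree-atom r win R ts
  win⇒agree r win ⊥̇           q = ⇔.refl
  win⇒agree r win (φ ∧̇ ψ)     q =
    win⇒agree r win φ (m⊔n≤o⇒m≤o _ _ q) ×-⇔ win⇒agree r win ψ (m⊔n≤o⇒n≤o (quantifierDepth φ) _ q)
  win⇒agree r win (φ ∨̇ ψ)     q =
    win⇒agree r win φ (m⊔n≤o⇒m≤o _ _ q) ⊎-⇔ win⇒agree r win ψ (m⊔n≤o⇒n≤o (quantifierDepth φ) _ q)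
  win⇒agree r win (φ ⇒̇ ψ)     q =
    →-cong-⇔ (win⇒agree r win φ (m⊔n≤o⇒m≤o _ _ q))
             (win⇒agree r win ψ (m⊔n≤o⇒n≤o (quantifierDepth φ) _ q))
  win⇒agree (suc r) (forth , back) (∀̇ φ) (s≤s q) = mk⇔
    -- To pass to B, the arbitrary `b` is taken as Spoiler's move and the hypothesis is used at
    -- Duplicator's answer in A.
    (λ sat b → let a , win = back b in to (win⇒agree r win φ q) (sat a))
    (λ sat a → let b , win = forth a in from (win⇒agree r win φ q) (sat b))
  win⇒agree (suc r) (forth , back) (∃̇ φ) (s≤s q) = mk⇔
    (λ (a , sat) → let b , win = forth a in b , to (win⇒agree r win φ q) sat)
    (λ (b , sat) → let a , win = back b in a , from (win⇒agree r win φ q) sat)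

inexpressible : ∀ {p} (P : Property σ p) →
                (∀ n → ∃₂ λ (A B : FiniteStructure σ) → (A ≡[ n ] B) × Has P A × ¬ Has P B) →
                ¬ Expressible P
inexpressible P separated (Φ , expresses)
  with A , B , win , PA , ¬PB ← separated (quantifierDepth Φ)
  = ¬PB (to (expresses B) (to agree (from (expresses A) PA)))
  where
  -- Nonemptiness supplies the dummy move.
  agree = win⇒agree (structure A) (structure B) (nonempty A) _ win Φ ≤-refl

-- Terms of bounded depth

vecs : {X : Set a} → List X → (n : ℕ) → List (Vec X n)
vecs xs zero    = [] ∷ []
vecs xs (suc n) = cartesianProductWith _∷_ xs (vecs xs n)

∈-vecs : {X : Set a} {xs : List X} {v : Vec X n} → All (_∈ xs) v → v ∈ vecs xs n
∈-vecs []       = here refl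
∈-vecs (p ∷ ps) = ∈-cartesianProductWith⁺ _∷_ p (∈-vecs ps)

applications : List (Term σ k) → List (Term σ k)
applications {σ} ts = concatMap (λ f → mapᴸ (app f) (vecs ts (opArity σ f))) (allFin (#ops σ))

∈-applications : {ts : List (Term σ k)} (f : Fin (#ops σ)) {us : Vec (Term σ k) (opArity σ f)} →
                 All (_∈ ts) us → app f us ∈ applications ts
∈-applications f us∈ts = ∈-concatMap⁺ _ (lose (∈-allFin f) (∈-map⁺ (app f) (∈-vecs us∈ts)))

terms : ℕ → List (Term σ k)
terms zero    = mapᴸ var (allFin _)
terms (suc d) = terms d ++ applications (terms d)

terms-mono : ∀ {d e} → d ≤′ e → {t : Term σ k} → t ∈ terms d → t ∈ terms e
terms-mono ≤′-refl       = id
terms-mono (≤′-step d≤e) = ∈-++⁺ˡ ∘ terms-mono d≤e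

var∈terms : ∀ d (i : Fin k) → var {σ} i ∈ terms d
var∈terms zero    i = ∈-map⁺ var (∈-allFin i)
var∈terms (suc d) i = ∈-++⁺ˡ (var∈terms d i)

module _ (A : Structure σ) {k : ℕ} (as : Vec (Carrier A) k) where

  ValueOf : List (Term σ k) → Carrier A → Set
  ValueOf ts x = ∃[ t ] t ∈ ts × eval A as t ≡ x

  ValuesOf : List (Term σ k) → Vec (Carrier A) n → Set
  ValuesOf ts xs = ∃[ us ] All (_∈ ts) us × evals A as us ≡ xs

  valuesOf : {ts : List (Term σ k)} {xs : Vec (Carrier A) n} →
             All (ValueOf ts) xs → ValuesOf ts xs
  valuesOf []                     = [] , [] , refl
  valuesOf ((t , t∈ts , eq) ∷ ps) with us , us∈ts , eqs ← valuesOf ps =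
    t ∷ us , t∈ts ∷ us∈ts , cong₂ _∷_ eq eqs

  valueOf-mono : ∀ {d e} → d ≤ e → ∀ {x} → ValueOf (terms d) x → ValueOf (terms e) x
  valueOf-mono d≤e (t , t∈ , eq) = t , terms-mono (≤⇒≤′ d≤e) t∈ , eq

  -- As `terms (suc d)` contains all applications to terms in `terms d`, this says that the values
  -- at depth `d` are closed under the operations.
  Saturated : ℕ → Set
  Saturated d = ∀ {x} → ValueOf (terms (suc d)) x → ValueOf (terms d) x

  module _ {d : ℕ} (saturated : Saturated d) where
    mutual
      generated⇒value : ∀ {x} → Generated A as x → ValueOf (terms d) x
      generated⇒value (generator i) = var i , var∈terms d i , refl
      generated⇒value (apply f ps)  with us , us∈ , eq ← valuesOf (generated⇒values ps) =
        saturated (app f us , ∈-++⁺ʳ (terms d) (∈-applications f us∈) , cong (op A f) eq)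

      generated⇒values : ∀ {n} {xs : Vec (Carrier A) n} →
                         All (Generated A as) xs → All (ValueOf (terms d)) xs
      generated⇒values []       = []
      generated⇒values (p ∷ ps) = generated⇒value p ∷ generated⇒values ps

  -- Otherwise every depth d ≤ m contributes a new element, giving m + 1 elements.
  ∃-saturated : ExcludedMiddle 0ℓ → ∀ m → Carrier ⟨ A ∣ as ⟩ ↣ Fin m →
                ∃[ d ] d ≤ m × Saturated d
  ∃-saturated em m inj with em {∃[ d ] d ≤ m × Saturated d}
  ... | yes found = found
  ... | no  none  = contradiction (pigeonhole (n<1+n m) (Injection.to inj ∘ newElement)) collision
    where
    new : (i : Fin (suc m)) →
          ∃[ x ] ValueOf (terms (suc (toℕ i))) x × ¬ ValueOf (terms (toℕ i)) x
    new i with em {∃[ x ] ValueOf (terms (suc (toℕ i))) x × ¬ ValueOf (terms (toℕ i)) x}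
    ... | yes found = found
    ... | no  none′ = contradiction
      -- If depth `toℕ i + 1` gave no new value, `toℕ i` would be a saturated depth at most `m`.
      (toℕ i , s≤s⁻¹ (toℕ<n i) , λ v → em⇒dne em (λ ¬v → none′ (_ , v , ¬v))) none

    newElement : Fin (suc m) → Carrier ⟨ A ∣ as ⟩
    newElement i with t , _ ← proj₁ (proj₂ (new i)) = ⟦_⟧ A as t

    value-newElement : ∀ i → value (newElement i) ≡ proj₁ (new i)
    value-newElement i with new i
    ... | _ , (_ , _ , eq) , _ = eq

    collision : ¬ ∃₂ λ i j → i <ᶠ j × Injection.to inj (newElement i) ≡ Injection.to inj (newElement j)
    collision (i , j , i<j , eq) =
      -- As i < j, the element new at stage `i` is already a value at depth `toℕ j`, so it cannot be
      -- new at stage `j`.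
      proj₂ (proj₂ (new j)) (subst (ValueOf (terms (toℕ j))) same
        (valueOf-mono i<j (proj₁ (proj₂ (new i)))))
      where
      same : proj₁ (new i) ≡ proj₁ (new j)
      same = trans (sym (value-newElement i))
            (trans (cong value (Injection.injective inj eq)) (value-newElement j))

  Covered : List (Term σ k) → Set
  Covered ts = ∀ {x} → Generated A as x → ValueOf ts x

  -- The saturated depth varies with the structure and the tuple; raising it to `m` makes it depend
  -- on the bound alone.
  covered : ExcludedMiddle 0ℓ → ∀ m → Carrier ⟨ A ∣ as ⟩ ↣ Fin m → Covered (terms m)
  covered em m inj p with d , d≤m , saturated ← ∃-saturated em m inj =
    valueOf-mono d≤m (generated⇒value {d} saturated p)

-- Isomorphism of generated substructures from finitely many atomic formulas

equations : List (Term σ k) → List (Formula σ k)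
equations ts = cartesianProductWith _≐_ ts ts

atoms : List (Term σ k) → List (Formula σ k)
atoms {σ} ts = concatMap (λ r → mapᴸ (atom r) (vecs ts (relArity σ r))) (allFin (#rels σ))

-- Depth m suffices to name all elements, and depth m + 1 to describe the operations.
diagram : ℕ → List (Formula σ k)
diagram m = equations (terms (suc m)) ++ atoms (terms m)

AgreeOn : (A B : Structure σ) → Vec (Carrier A) k → Vec (Carrier B) k → List (Formula σ k) → Set
AgreeOn A B as bs φs = ∀ {φ} → φ ∈ φs → Agree A B as bs φ

agreeOn-sym : (A B : Structure σ) {as : Vec (Carrier A) k} {bs : Vec (Carrier B) k}
              {φs : List (Formula σ k)} → AgreeOn A B as bs φs → AgreeOn B A bs as φs
agreeOn-sym A B agree φ∈φs = ⇔.sym (agree φ∈φs)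

module _ (em : ExcludedMiddle 0ℓ) (m : ℕ) where

  module Transfer (A B : Structure σ) {k : ℕ} {as : Vec (Carrier A) k} {bs : Vec (Carrier B) k}
                  (coveredA : Covered A as (terms m))
                  (agree : AgreeOn A B as bs (diagram m)) where

    agree-≐ : ∀ {s t} → s ∈ terms (suc m) → t ∈ terms (suc m) → Agree A B as bs (s ≐ t)
    agree-≐ s∈ t∈ = agree (∈-++⁺ˡ (∈-cartesianProductWith⁺ _≐_ s∈ t∈))

    agree-atom : ∀ r {ts} → All (_∈ terms m) ts → Agree A B as bs (atom r ts)
    agree-atom r ts∈ = agree (∈-++⁺ʳ (equations (terms (suc m)))
      (∈-concatMap⁺ _ (lose (∈-allFin r) (∈-map⁺ (atom r) (∈-vecs ts∈)))))

    name : (x : Carrier ⟨ A ∣ as ⟩) → ValueOf A as (terms m) (value x)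
    -- The proof `p` is irrelevant, so a term cannot be read off from it; excluded middle decides
    -- whether one exists, and `recompute` then yields it.
    name (x , [ p ]) = recompute em (coveredA p)

    transfer : Carrier ⟨ A ∣ as ⟩ → Carrier ⟨ B ∣ bs ⟩
    transfer x = ⟦_⟧ B bs (proj₁ (name x))

    -- The choice of name does not matter: two names of one element give an equation true in A,
    -- hence true in B.
    value-transfer : ∀ x {t} → t ∈ terms (suc m) → eval A as t ≡ value x →
                     value (transfer x) ≡ eval B bs t
    value-transfer x t∈ eq with s , s∈ , eq′ ← name x =
      to (agree-≐ (∈-++⁺ˡ s∈) t∈) (trans eq′ (sym eq))

    names : ∀ {n} (xs : Vec (Carrier ⟨ A ∣ as ⟩) n) →
            ∃[ ts ] All (_∈ terms m) ts × evals A as ts ≡ map value xs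
                                        × evals B bs ts ≡ map value (map transfer xs)
    names []       = [] , [] , refl , refl
    names (x ∷ xs) with t , t∈ , eq ← name x | ts , ts∈ , eqA , eqB ← names xs =
      t ∷ ts , t∈ ∷ ts∈ , cong₂ _∷_ eq eqA , cong (eval B bs t ∷_) eqB

    transfer-op : ∀ f xs → transfer (op ⟨ A ∣ as ⟩ f xs) ≡ op ⟨ B ∣ bs ⟩ f (map transfer xs)
    transfer-op f xs with ts , ts∈ , eqA , eqB ← names xs = value-injective B bs
      -- Applying `f` to names of depth `m` gives a second name of the result, of depth m + 1.
      (trans (value-transfer (op ⟨ A ∣ as ⟩ f xs) (∈-++⁺ʳ (terms m) (∈-applications f ts∈))
                             (cong (op A f) eqA))
             (cong (op B f) eqB))

    transfer-rel : ∀ r xs → rel ⟨ A ∣ as ⟩ r xs ⇔ rel ⟨ B ∣ bs ⟩ r (map transfer xs)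
    transfer-rel r xs with ts , ts∈ , eqA , eqB ← names xs
      with iff ← agree-atom r ts∈ rewrite eqA | eqB = iff

    transfer-gen : ∀ i → transfer (gen A as i) ≡ gen B bs i
    transfer-gen i = value-injective B bs (value-transfer (gen A as i) (var∈terms (suc m) i) refl)

  -- The name `t` of `x` in A also names its image in B, so going back may be computed with `t`.
  transfer-inverse :
    (A B : Structure σ) {as : Vec (Carrier A) k} {bs : Vec (Carrier B) k}
    (coveredA : Covered A as (terms m)) (coveredB : Covered B bs (terms m))
    (agree : AgreeOn A B as bs (diagram m)) (agree′ : AgreeOn B A bs as (diagram m)) →
    ∀ x → Transfer.transfer B A coveredB agree′ (Transfer.transfer A B coveredA agree x) ≡ x
  transfer-inverse A B {as} {bs} coveredA coveredB agree agree′ x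
    with t , t∈ , eq ← Transfer.name A B coveredA agree x = value-injective A as
      (trans (Transfer.value-transfer B A coveredB agree′ (⟦_⟧ B bs t) (∈-++⁺ˡ t∈) refl) eq)

  agreeOn-diagram⇒finalWin :
    (A B : Structure σ) {as : Vec (Carrier A) k} {bs : Vec (Carrier B) k} →
    Covered A as (terms m) → Covered B bs (terms m) →
    AgreeOn A B as bs (diagram m) → FinalWin A B as bs
  agreeOn-diagram⇒finalWin A B coveredA coveredB agree = record
    { bijection = mk↔ₛ′ AB.transfer BA.transfer
        (transfer-inverse B A coveredB coveredA agree′ agree)
        (transfer-inverse A B coveredA coveredB agree agree′)
    ; op-homo   = AB.transfer-op
    ; rel-iff   = AB.transfer-rel
    } , AB.transfer-gen
    where
    agree′ = agreeOn-sym A B agree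
    module AB = Transfer A B coveredA agree
    module BA = Transfer B A coveredB agree′

-- Complete types over a finite list of formulas

completeTypes : List (Formula σ k) → List (Formula σ k)
-- An implication that always holds serves as the empty conjunction.
completeTypes []       = (⊥̇ ⇒̇ ⊥̇) ∷ []
completeTypes (φ ∷ φs) = mapᴸ (φ ∧̇_) (completeTypes φs) ++ mapᴸ ((φ ⇒̇ ⊥̇) ∧̇_) (completeTypes φs)

∃-completeType : ExcludedMiddle 0ℓ → (A : Structure σ) (as : Vec (Carrier A) k)
                 (φs : List (Formula σ k)) → ∃[ χ ] χ ∈ completeTypes φs × Sat A as χ
∃-completeType em A as []       = _ , here refl , id
∃-completeType em A as (φ ∷ φs) with χ , χ∈ , sat ← ∃-completeType em A as φs | em {Sat A as φ}
... | yes satφ = _ , ∈-++⁺ˡ (∈-map⁺ (φ ∧̇_) χ∈) , satφ , sat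
... | no ¬satφ = _ , ∈-++⁺ʳ _ (∈-map⁺ ((φ ⇒̇ ⊥̇) ∧̇_) χ∈) , ¬satφ , sat

completeType⇒agreeOn : (A B : Structure σ) {as : Vec (Carrier A) k} {bs : Vec (Carrier B) k}
                       (φs : List (Formula σ k)) {χ : Formula σ k} → χ ∈ completeTypes φs →
                       Sat A as χ → Sat B bs χ → AgreeOn A B as bs φs
completeType⇒agreeOn A B (φ ∷ φs) χ∈ satA satB φ∈
  with ∈-++⁻ (mapᴸ (φ ∧̇_) (completeTypes φs)) χ∈
... | inj₁ p with _ , ψ∈ , refl ← ∈-map⁻ (φ ∧̇_) p with φ∈
...   | here refl = mk⇔ (λ _ → proj₁ satB) (λ _ → proj₁ satA)
...   | there q   = completeType⇒agreeOn A B φs ψ∈ (proj₂ satA) (proj₂ satB) q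
completeType⇒agreeOn A B (φ ∷ φs) χ∈ satA satB φ∈
    | inj₂ p with _ , ψ∈ , refl ← ∈-map⁻ ((φ ⇒̇ ⊥̇) ∧̇_) p with φ∈
...   | here refl = mk⇔ (λ satφ → contradiction satφ (proj₁ satA)) (λ satφ → contradiction satφ (proj₁ satB))
...   | there q   = completeType⇒agreeOn A B φs ψ∈ (proj₂ satA) (proj₂ satB) q

⋁̇ : List (Formula σ k) → Formula σ k
⋁̇ = foldr _∨̇_ ⊥̇

module _ (A : Structure σ) {as : Vec (Carrier A) k} where

  sat-⋁̇⁺ : ∀ {φ φs} → φ ∈ φs → Sat A as φ → Sat A as (⋁̇ φs)
  sat-⋁̇⁺ (here refl) sat = inj₁ sat
  sat-⋁̇⁺ (there φ∈)  sat = inj₂ (sat-⋁̇⁺ φ∈ sat)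

  sat-⋁̇⁻ : ∀ φs → Sat A as (⋁̇ φs) → ∃[ φ ] φ ∈ φs × Sat A as φ
  sat-⋁̇⁻ (φ ∷ φs) (inj₁ sat) = φ , here refl , sat
  sat-⋁̇⁻ (φ ∷ φs) (inj₂ sat) with ψ , ψ∈ , sat′ ← sat-⋁̇⁻ φs sat = ψ , there ψ∈ , sat′

-- Formulas that decide the game

module _ {u} (em : ExcludedMiddle 0ℓ) {𝒰 : Class σ u} (ulf : UniformlyLocallyFinite 𝒰) where

  -- A variant of Hintikka formulas, saying which complete types can be reached by one more move.
  -- Each step raises the implicit `k`, so the bound `m` is taken for the tuple at the end of the
  -- game.
  decisive : (r : ℕ) {k : ℕ} → List (Formula σ k)
  decisive zero    {k} = diagram (proj₁ (ulf k))
  decisive (suc r)     = mapᴸ ∃̇_ (completeTypes (decisive r))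

  -- Duplicator answers with a witness in B for the complete type that Spoiler's move realises in A.
  decisive-answer : ∀ r (A B : Structure σ) {k} {as : Vec (Carrier A) k} {bs : Vec (Carrier B) k} →
                    AgreeOn A B as bs (decisive (suc r)) →
                    ∀ a → ∃[ b ] AgreeOn A B (a ∷ as) (b ∷ bs) (decisive r)
  decisive-answer r A B {as = as} agree a
    with χ , χ∈ , satA ← ∃-completeType em A (a ∷ as) (decisive r)
    with b , satB ← to (agree (∈-map⁺ ∃̇_ χ∈)) (a , satA)
    = b , completeType⇒agreeOn A B (decisive r) χ∈ satA satB

  agreeOn-decisive⇒win :
    ∀ r {A B : FiniteStructure σ} → 𝒰 A → 𝒰 B →
    ∀ {k} {as : Vec (Carrier (structure A)) k} {bs : Vec (Carrier (structure B)) k} →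
    AgreeOn (structure A) (structure B) as bs (decisive r) →
    WinningStrategy (structure A) (structure B) r as bs
  agreeOn-decisive⇒win zero {A} {B} A∈𝒰 B∈𝒰 {k} {as} {bs} agree with m , bounded ← ulf k =
    agreeOn-diagram⇒finalWin em m (structure A) (structure B)
      (covered (structure A) as em m (bounded A A∈𝒰 as))
      (covered (structure B) bs em m (bounded B B∈𝒰 bs)) agree
  agreeOn-decisive⇒win (suc r) {A} {B} A∈𝒰 B∈𝒰 agree =
    (λ a → let b , agree′ = decisive-answer r (structure A) (structure B) agree a
           in b , agreeOn-decisive⇒win r A∈𝒰 B∈𝒰 agree′) ,
    (λ b → let a , agree′ = decisive-answer r (structure B) (structure A)
                              (agreeOn-sym (structure A) (structure B) agree) b
           in a , agreeOn-decisive⇒win r A∈𝒰 B∈𝒰 (agreeOn-sym (structure B) (structure A) agree′))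

-- Separated pairs from inexpressibility

separated : ∀ {p u} → ExcludedMiddle (lsuc 0ℓ ⊔ p ⊔ u) →
            (𝒰 : Class σ u) → UniformlyLocallyFinite 𝒰 →
            (P : Property σ p) → ¬ ExpressibleWithin 𝒰 P →
            ∀ n → ∃₂ λ (A B : FiniteStructure σ) →
              𝒰 A × 𝒰 B × (A ≡[ n ] B) × Has P A × ¬ Has P B
separated {σ} {p} {u} em 𝒰 ulf P inexpressible n = em⇒dne em λ none →
  inexpressible (Φ , λ A A∈𝒰 → mk⇔ (Φ⇒P none A A∈𝒰) (P⇒Φ A A∈𝒰))
  where
  em₀ : ExcludedMiddle 0ℓ
  em₀ = lower-em (lsuc 0ℓ ⊔ p ⊔ u) em

  φs : List (Sentence σ)
  φs = decisive em₀ ulf n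

  Realised : Sentence σ → Set _
  Realised χ = ∃[ A ] 𝒰 A × Has P A × A ⊨ χ

  realised? : ∀ χ → Dec (Realised χ)
  -- This quantifies over all structures in 𝒰 with the property, which is why excluded middle is
  -- needed above level `0ℓ`.
  realised? χ = em

  Φ : Sentence σ
  Φ = ⋁̇ (filter realised? (completeTypes φs))

  P⇒Φ : ∀ A → 𝒰 A → Has P A → A ⊨ Φ
  P⇒Φ A A∈𝒰 PA with χ , χ∈ , sat ← ∃-completeType em₀ (structure A) [] φs =
    sat-⋁̇⁺ (structure A) (∈-filter⁺ realised? χ∈ (A , A∈𝒰 , PA , sat)) sat

  Φ⇒P : ¬ (∃₂ λ A B → 𝒰 A × 𝒰 B × (A ≡[ n ] B) × Has P A × ¬ Has P B) →
        ∀ B → 𝒰 B → B ⊨ Φ → Has P B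
  Φ⇒P none B B∈𝒰 satΦ
    -- The disjunct true in B is also realised by some A in 𝒰 with P, so Duplicator wins between A
    -- and B; were P to fail in B, `none` would be violated.
    with χ , χ∈ , satB ← sat-⋁̇⁻ (structure B) (filter realised? (completeTypes φs)) satΦ
    with χ∈types , A , A∈𝒰 , PA , satA ← ∈-filter⁻ realised? {xs = completeTypes φs} χ∈
    = em⇒dne (lower-em (lsuc 0ℓ ⊔ u) em) λ ¬PB → none
        (A , B , A∈𝒰 , B∈𝒰
        , agreeOn-decisive⇒win em₀ ulf n A∈𝒰 B∈𝒰
            (completeType⇒agreeOn (structure A) (structure B) φs χ∈types satA satB)
        , PA , ¬PB)

theorem5p2 : ∀ {p u : Level} (σ : Signature) →
    ((P : Property σ p) →
    (∀ (n : ℕ) → ∃₂ λ (A B : FiniteStructure σ) →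
    (A ≡[ n ] B) × Has P A × ¬ Has P B) →
    ¬ Expressible P)
    ×
    (ExcludedMiddle (lsuc 0ℓ ⊔ p ⊔ u) →
    (𝒰 : Class σ u) → UniformlyLocallyFinite 𝒰 →
    (P : Property σ p) → ¬ ExpressibleWithin 𝒰 P →
    ∀ (n : ℕ) → ∃₂ λ (A B : FiniteStructure σ) →
    𝒰 A × 𝒰 B × (A ≡[ n ] B) × Has P A × ¬ Has P B)
theorem5p2 σ = inexpressible , separated
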